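{- For every real $\epsilon$ with $0<\epsilon<0.5$ there is a real constant $\delta=\delta(\epsilon)>0$ such that the following holds. Let $n$ be a positive integer, let $r=2c$ for an odd integer $c$ with $1\le c\le\frac{n}{2}$, and let $k$ be an even integer with $\epsilon n<k<(1-\epsilon)n$. Then $\gamma(n,k,r)\geq\delta n$.
   Context: $[n]=\{1,\ldots,n\}$. A bicoloring of $[n]$ is a map $B:[n]\to\{ -1,+1\}$; it is a $k$-bicoloring if it takes the value $+1$ on exactly $k$ points. Put $Y_B=(B(1),\ldots,B(n))$, and for $A\subseteq[n]$ let $X_A\in\{0,1\}^n$ be its incidence vector. A non-empty set $A\subseteq[n]$ is an unbiased representative for $B$ if $\langle X_A,Y_B\rangle=0$. A family $\mathcal{A}$ of subsets of $[n]$ is a system of unbiased representatives (SUR) for a set $\mathcal{B}$ of bicolorings if every $B\in\mathcal{B}$ has an unbiased representative in $\mathcal{A}$. $\gamma(n,k,r)$ is the maximum, over all sets $\mathcal{B}$ of $k$-bicolorings of $[n]$, of the minimum cardinality of a SUR for $\mathcal{B}$ all of whose members have cardinality exactly $r$; equivalently, it is this minimum cardinality when $\mathcal{B}$ is the set of all $\binom{n}{k}$ $k$-bicolorings. (If no such SUR exists, the minimum is read as $+\infty$.) -}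

module Defs where

open import Algebra.Bundles using (CommutativeMonoid)
import Algebra.Properties.CommutativeSemigroup as CommutativeSemigroup
open import Data.Bool.Base using (if_then_else_)
open import Data.Fin.Subset using (Subset; inside; outside; Nonempty; ∣_∣)
open import Data.Fin.Subset.Properties using (nonempty?)
open import Data.Integer.Base using (ℤ; +_; 0ℤ; 1ℤ; _◃_)
import Data.Integer.Base as ℤ
import Data.Integer.Properties as ℤ
open import Data.List.Base using (List; []; _∷_; _++_; map; filter; foldr; length; cartesianProductWith)
open import Data.List.Relation.Unary.All using (All; all?)
open import Data.List.Relation.Unary.Any using (Any; any?)
open import Data.Nat.Base using (ℕ; zero; suc)
import Data.Nat.Base as ℕ
import Data.Nat.Properties as ℕ
open import Data.Product.Base using (∃-syntax; _×_; _,_)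
open import Data.Rational.Base using (ℚ; 0ℚ; 1ℚ; positive; nonNegative; Positive)
import Data.Rational.Base as ℚ
import Data.Rational.Properties as ℚ
open import Data.Sign.Base using (Sign)
import Data.Sign.Base as Sign
import Data.Sign.Properties as Sign
open import Data.Unit.Base using (⊤)
open import Data.Vec.Base using (Vec; []; _∷_; count)
import Data.Vec.Base as Vec
open import Relation.Binary.PropositionalEquality.Core using (_≡_; sym; trans; cong; cong₂; subst)
open import Relation.Binary.PropositionalEquality.Properties using (module ≡-Reasoning)
open import Relation.Nullary.Construct.Add.Supremum using (_⁺; [_]; ⊤⁺)
open import Relation.Nullary.Decidable.Core using (_×-dec_)
open import Relation.Unary using (Decidable)

-- Real numbers, as Cauchy sequences of rationals. Equality of reals is
-- never needed, so the sequences are not quotiented.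

IsCauchy : (ℕ → ℚ) → Set
IsCauchy s = ∀ q → 0ℚ ℚ.< q →
  ∃[ N ] (∀ i j → N ℕ.≤ i → N ℕ.≤ j → ℚ.∣ s i ℚ.- s j ∣ ℚ.< q)

record ℝ : Set where
  constructor real
  field
    seq    : ℕ → ℚ
    cauchy : IsCauchy seq

open ℝ public

infix 4 _<ℝ_ _≤ℝ_

_<ℝ_ : ℝ → ℝ → Set
x <ℝ y = ∃[ q ] 0ℚ ℚ.< q × ∃[ N ] (∀ i → N ℕ.≤ i → seq x i ℚ.+ q ℚ.≤ seq y i)

_≤ℝ_ : ℝ → ℝ → Set
x ≤ℝ y = ∀ q → 0ℚ ℚ.< q → ∃[ N ] (∀ i → N ℕ.≤ i → seq x i ℚ.≤ seq y i ℚ.+ q)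

fromℚ : ℚ → ℝ
fromℚ p = real (λ _ → p) λ q 0<q →
  0 , λ _ _ _ _ → subst (ℚ._< q) (sym (cong ℚ.∣_∣ (ℚ.+-inverseʳ p))) 0<q

fromℕ : ℕ → ℝ
fromℕ n = fromℚ (+ n ℚ./ 1)

private
  open CommutativeSemigroup (CommutativeMonoid.commutativeSemigroup ℚ.+-0-commutativeMonoid)
    using (interchange)

  shift : ∀ a b → a ≡ (a ℚ.- b) ℚ.+ b
  shift a b = begin
    a                    ≡⟨ ℚ.+-identityʳ a ⟨
    a ℚ.+ 0ℚ             ≡⟨ cong (a ℚ.+_) (ℚ.+-inverseˡ b) ⟨
    a ℚ.+ (ℚ.- b ℚ.+ b)  ≡⟨ ℚ.+-assoc a (ℚ.- b) b ⟨
    (a ℚ.- b) ℚ.+ b      ∎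
    where open ≡-Reasoning

  telescope : ∀ a b c → a ℚ.- c ≡ (a ℚ.- b) ℚ.+ (b ℚ.- c)
  telescope a b c = begin
    a ℚ.- c                    ≡⟨ cong (ℚ._- c) (shift a b) ⟩
    ((a ℚ.- b) ℚ.+ b) ℚ.- c    ≡⟨ ℚ.+-assoc (a ℚ.- b) b (ℚ.- c) ⟩
    (a ℚ.- b) ℚ.+ (b ℚ.- c)    ∎
    where open ≡-Reasoning

  differenceOfDifferences : ∀ a b c d →
    (a ℚ.- b) ℚ.- (c ℚ.- d) ≡ (a ℚ.- c) ℚ.- (b ℚ.- d)
  differenceOfDifferences a b c d = begin
    (a ℚ.- b) ℚ.- (c ℚ.- d)
      ≡⟨ cong ((a ℚ.- b) ℚ.+_) (ℚ.neg-distrib-+ c (ℚ.- d)) ⟩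
    (a ℚ.- b) ℚ.+ (ℚ.- c ℚ.- ℚ.- d)
      ≡⟨ interchange a (ℚ.- b) (ℚ.- c) (ℚ.- (ℚ.- d)) ⟩
    (a ℚ.- c) ℚ.+ (ℚ.- b ℚ.- ℚ.- d)
      ≡⟨ cong ((a ℚ.- c) ℚ.+_) (ℚ.neg-distrib-+ b (ℚ.- d)) ⟨
    (a ℚ.- c) ℚ.- (b ℚ.- d) ∎
    where open ≡-Reasoning

  differenceOfProducts : ∀ a b c d →
    a ℚ.* b ℚ.- c ℚ.* d ≡ a ℚ.* (b ℚ.- d) ℚ.+ d ℚ.* (a ℚ.- c)
  differenceOfProducts a b c d = begin
    a ℚ.* b ℚ.- c ℚ.* d
      ≡⟨ telescope (a ℚ.* b) (a ℚ.* d) (c ℚ.* d) ⟩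
    (a ℚ.* b ℚ.- a ℚ.* d) ℚ.+ (a ℚ.* d ℚ.- c ℚ.* d)
      ≡⟨ cong₂ (λ p q → (a ℚ.* b ℚ.+ p) ℚ.+ (a ℚ.* d ℚ.+ q))
           (ℚ.neg-distribʳ-* a d) (ℚ.neg-distribˡ-* c d) ⟩
    (a ℚ.* b ℚ.+ a ℚ.* (ℚ.- d)) ℚ.+ (a ℚ.* d ℚ.+ (ℚ.- c) ℚ.* d)
      ≡⟨ cong₂ ℚ._+_ (ℚ.*-distribˡ-+ a b (ℚ.- d)) (ℚ.*-distribʳ-+ d a (ℚ.- c)) ⟨
    a ℚ.* (b ℚ.- d) ℚ.+ (a ℚ.- c) ℚ.* d
      ≡⟨ cong (a ℚ.* (b ℚ.- d) ℚ.+_) (ℚ.*-comm (a ℚ.- c) d) ⟩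
    a ℚ.* (b ℚ.- d) ℚ.+ d ℚ.* (a ℚ.- c) ∎
    where open ≡-Reasoning

  quotient : ∀ q m → 0ℚ ℚ.< q → 0ℚ ℚ.< m → ∃[ d ] 0ℚ ℚ.< d × m ℚ.* d ≡ q
  quotient q m 0<q 0<m = 1/m ℚ.* q , 0<d , eq
    where
    instance
      m-pos : Positive m
      m-pos = positive 0<m
      m≢0 : ℚ.NonZero m
      m≢0 = ℚ.pos⇒nonZero m
    1/m : ℚ
    1/m = ℚ.1/ m
    instance
      1/m-pos : Positive 1/m
      1/m-pos = ℚ.1/pos⇒pos m
    0<d : 0ℚ ℚ.< 1/m ℚ.* q
    0<d = subst (ℚ._< 1/m ℚ.* q) (ℚ.*-zeroʳ 1/m) (ℚ.*-monoʳ-<-pos 1/m 0<q)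
    eq : m ℚ.* (1/m ℚ.* q) ≡ q
    eq = trans (sym (ℚ.*-assoc m 1/m q))
           (trans (cong (ℚ._* q) (ℚ.*-inverseʳ m)) (ℚ.*-identityˡ q))

  split : ∀ q m n → 0ℚ ℚ.< q → 0ℚ ℚ.< m → 0ℚ ℚ.< n →
          ∃[ d ] 0ℚ ℚ.< d × m ℚ.* d ℚ.+ n ℚ.* d ≡ q
  split q m n 0<q 0<m 0<n =
    let d , 0<d , eq = quotient q (m ℚ.+ n) 0<q (ℚ.+-mono-< 0<m 0<n)
    in  d , 0<d , trans (sym (ℚ.*-distribʳ-+ d m n)) eq

  halve : ∀ q → 0ℚ ℚ.< q → ∃[ d ] 0ℚ ℚ.< d × d ℚ.+ d ≡ q
  halve q 0<q =
    let d , 0<d , eq = split q 1ℚ 1ℚ 0<q (ℚ.positive⁻¹ 1ℚ) (ℚ.positive⁻¹ 1ℚ)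
    in  d , 0<d , trans (sym (cong₂ ℚ._+_ (ℚ.*-identityˡ d) (ℚ.*-identityˡ d))) eq

  bounded : ∀ x → ∃[ M ] 0ℚ ℚ.< M × ∃[ N ] (∀ i → N ℕ.≤ i → ℚ.∣ seq x i ∣ ℚ.≤ M)
  bounded x with cauchy x 1ℚ (ℚ.positive⁻¹ 1ℚ)
  ... | N , close = 1ℚ ℚ.+ ℚ.∣ seq x N ∣ ,
      ℚ.+-mono-<-≤ (ℚ.positive⁻¹ 1ℚ) (ℚ.0≤∣p∣ (seq x N)) , N , bound
    where
    bound : ∀ i → N ℕ.≤ i → ℚ.∣ seq x i ∣ ℚ.≤ 1ℚ ℚ.+ ℚ.∣ seq x N ∣
    bound i N≤i = begin
      ℚ.∣ seq x i ∣
        ≡⟨ cong ℚ.∣_∣ (shift (seq x i) (seq x N)) ⟩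
      ℚ.∣ (seq x i ℚ.- seq x N) ℚ.+ seq x N ∣
        ≤⟨ ℚ.∣p+q∣≤∣p∣+∣q∣ (seq x i ℚ.- seq x N) (seq x N) ⟩
      ℚ.∣ seq x i ℚ.- seq x N ∣ ℚ.+ ℚ.∣ seq x N ∣
        ≤⟨ ℚ.+-monoˡ-≤ ℚ.∣ seq x N ∣ (ℚ.<⇒≤ (close i N N≤i ℕ.≤-refl)) ⟩
      1ℚ ℚ.+ ℚ.∣ seq x N ∣ ∎
      where open ℚ.≤-Reasoning

infixl 6 _-ℝ_
infixl 7 _*ℝ_

_-ℝ_ : ℝ → ℝ → ℝ
x -ℝ y = real (λ i → seq x i ℚ.- seq y i) isCauchy
  where
  isCauchy : IsCauchy (λ i → seq x i ℚ.- seq y i)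
  isCauchy q 0<q =
    let d , 0<d , d+d≡q = halve q 0<q
        N₁ , close₁ = cauchy x d 0<d
        N₂ , close₂ = cauchy y d 0<d
    in N₁ ℕ.⊔ N₂ , λ i j N≤i N≤j → begin-strict
    ℚ.∣ (seq x i ℚ.- seq y i) ℚ.- (seq x j ℚ.- seq y j) ∣
      ≡⟨ cong ℚ.∣_∣ (differenceOfDifferences (seq x i) (seq y i) (seq x j) (seq y j)) ⟩
    ℚ.∣ (seq x i ℚ.- seq x j) ℚ.- (seq y i ℚ.- seq y j) ∣
      ≤⟨ ℚ.∣p-q∣≤∣p∣+∣q∣ (seq x i ℚ.- seq x j) (seq y i ℚ.- seq y j) ⟩
    ℚ.∣ seq x i ℚ.- seq x j ∣ ℚ.+ ℚ.∣ seq y i ℚ.- seq y j ∣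
      <⟨ ℚ.+-mono-< (close₁ i j (ℕ.m⊔n≤o⇒m≤o N₁ N₂ N≤i) (ℕ.m⊔n≤o⇒m≤o N₁ N₂ N≤j))
                    (close₂ i j (ℕ.m⊔n≤o⇒n≤o N₁ N₂ N≤i) (ℕ.m⊔n≤o⇒n≤o N₁ N₂ N≤j)) ⟩
    d ℚ.+ d
      ≡⟨ d+d≡q ⟩
    q ∎
    where open ℚ.≤-Reasoning

_*ℝ_ : ℝ → ℝ → ℝ
x *ℝ y = real (λ i → seq x i ℚ.* seq y i) isCauchy
  where
  scaled : ∀ a b M d → 0ℚ ℚ.< M → ℚ.∣ a ∣ ℚ.≤ M → ℚ.∣ b ∣ ℚ.< d →
           ℚ.∣ a ℚ.* b ∣ ℚ.< M ℚ.* d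
  scaled a b M d 0<M a≤M b<d = begin-strict
    ℚ.∣ a ℚ.* b ∣         ≡⟨ ℚ.∣p*q∣≡∣p∣*∣q∣ a b ⟩
    ℚ.∣ a ∣ ℚ.* ℚ.∣ b ∣   ≤⟨ ℚ.*-monoʳ-≤-nonNeg ℚ.∣ b ∣ {{nonNegative (ℚ.0≤∣p∣ b)}} a≤M ⟩
    M ℚ.* ℚ.∣ b ∣         <⟨ ℚ.*-monoʳ-<-pos M {{positive 0<M}} b<d ⟩
    M ℚ.* d               ∎
    where open ℚ.≤-Reasoning

  isCauchy : IsCauchy (λ i → seq x i ℚ.* seq y i)
  isCauchy q 0<q =
    let Mx , 0<Mx , Kx , x≤Mx = bounded x
        My , 0<My , Ky , y≤My = bounded y
        d , 0<d , Md+Md≡q = split q Mx My 0<q 0<Mx 0<My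
        Nx , closeˣ = cauchy x d 0<d
        Ny , closeʸ = cauchy y d 0<d
        K = Kx ℕ.⊔ Ky
        N = Nx ℕ.⊔ Ny
    in K ℕ.⊔ N , λ i j ≤i ≤j →
      let K≤i = ℕ.m⊔n≤o⇒m≤o K N ≤i
          K≤j = ℕ.m⊔n≤o⇒m≤o K N ≤j
          N≤i = ℕ.m⊔n≤o⇒n≤o K N ≤i
          N≤j = ℕ.m⊔n≤o⇒n≤o K N ≤j
          a = seq x i
          b = seq y i
          a′ = seq x j
          b′ = seq y j
      in begin-strict
      ℚ.∣ a ℚ.* b ℚ.- a′ ℚ.* b′ ∣
        ≡⟨ cong ℚ.∣_∣ (differenceOfProducts a b a′ b′) ⟩
      ℚ.∣ a ℚ.* (b ℚ.- b′) ℚ.+ b′ ℚ.* (a ℚ.- a′) ∣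
        ≤⟨ ℚ.∣p+q∣≤∣p∣+∣q∣ (a ℚ.* (b ℚ.- b′)) (b′ ℚ.* (a ℚ.- a′)) ⟩
      ℚ.∣ a ℚ.* (b ℚ.- b′) ∣ ℚ.+ ℚ.∣ b′ ℚ.* (a ℚ.- a′) ∣
        <⟨ ℚ.+-mono-<
             (scaled a (b ℚ.- b′) Mx d 0<Mx (x≤Mx i (ℕ.m⊔n≤o⇒m≤o Kx Ky K≤i))
               (closeʸ i j (ℕ.m⊔n≤o⇒n≤o Nx Ny N≤i) (ℕ.m⊔n≤o⇒n≤o Nx Ny N≤j)))
             (scaled b′ (a ℚ.- a′) My d 0<My (y≤My j (ℕ.m⊔n≤o⇒n≤o Kx Ky K≤j))
               (closeˣ i j (ℕ.m⊔n≤o⇒m≤o Nx Ny N≤i) (ℕ.m⊔n≤o⇒m≤o Nx Ny N≤j))) ⟩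
      Mx ℚ.* d ℚ.+ My ℚ.* d
        ≡⟨ Md+Md≡q ⟩
      q ∎
    where open ℚ.≤-Reasoning

-- ℕ ⁺ is ℕ ∪ {∞}, with ⊤⁺ as ∞.

_⊓⁺_ : ℕ ⁺ → ℕ ⁺ → ℕ ⁺
[ m ] ⊓⁺ [ n ] = [ m ℕ.⊓ n ]
[ m ] ⊓⁺ ⊤⁺    = [ m ]
⊤⁺    ⊓⁺ y     = y

_⊔⁺_ : ℕ ⁺ → ℕ ⁺ → ℕ ⁺
[ m ] ⊔⁺ [ n ] = [ m ℕ.⊔ n ]
[ m ] ⊔⁺ ⊤⁺    = ⊤⁺
⊤⁺    ⊔⁺ _     = ⊤⁺

-- The minimum of the empty list is ∞.
minimum : List (ℕ ⁺) → ℕ ⁺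
minimum = foldr _⊓⁺_ ⊤⁺

maximum : List (ℕ ⁺) → ℕ ⁺
maximum = foldr _⊔⁺_ [ 0 ]

infix 4 _≤⁺_

_≤⁺_ : ℝ → ℕ ⁺ → Set
x ≤⁺ [ m ] = x ≤ℝ fromℕ m
x ≤⁺ ⊤⁺    = ⊤

allVecs : {A : Set} → List A → (n : ℕ) → List (Vec A n)
allVecs xs zero    = [] ∷ []
allVecs xs (suc n) = cartesianProductWith _∷_ xs (allVecs xs n)

-- A list without repetitions represents a finite set; its subsets are then
-- represented, once each, by its sublists.
sublists : {A : Set} → List A → List (List A)
sublists []       = [] ∷ []
sublists (x ∷ xs) = map (x ∷_) (sublists xs) ++ sublists xs

Bicoloring : ℕ → Set
Bicoloring n = Vec Sign n

IsBicoloring : {n : ℕ} → ℕ → Bicoloring n → Set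
IsBicoloring k B = count (Sign._≟ Sign.+) B ≡ k

isBicoloring? : {n : ℕ} (k : ℕ) → Decidable (IsBicoloring {n} k)
isBicoloring? k B = count (Sign._≟ Sign.+) B ℕ.≟ k

X : {n : ℕ} → Subset n → Vec ℤ n
X = Vec.map (λ s → if s then 1ℤ else 0ℤ)

Y : {n : ℕ} → Bicoloring n → Vec ℤ n
Y = Vec.map (_◃ 1)

⟨_,_⟩ : {n : ℕ} → Vec ℤ n → Vec ℤ n → ℤ
⟨ u , v ⟩ = Vec.foldr′ ℤ._+_ 0ℤ (Vec.zipWith ℤ._*_ u v)

UnbiasedRepresentative : {n : ℕ} → Bicoloring n → Subset n → Set
UnbiasedRepresentative B A = Nonempty A × ⟨ X A , Y B ⟩ ≡ 0ℤ

SUR : {n : ℕ} → List (Bicoloring n) → List (Subset n) → Set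
SUR 𝓑 𝓐 = All (λ B → Any (UnbiasedRepresentative B) 𝓐) 𝓑

Uniform : {n : ℕ} → ℕ → List (Subset n) → Set
Uniform r = All (λ A → ∣ A ∣ ≡ r)

uniformSUR? : {n : ℕ} (r : ℕ) (𝓑 : List (Bicoloring n)) →
              Decidable (λ 𝓐 → SUR 𝓑 𝓐 × Uniform r 𝓐)
uniformSUR? r 𝓑 𝓐 =
  all? (λ B → any? (λ A → nonempty? A ×-dec (⟨ X A , Y B ⟩ ℤ.≟ 0ℤ)) 𝓐) 𝓑
  ×-dec all? (λ A → ∣ A ∣ ℕ.≟ r) 𝓐

allSubsets : (n : ℕ) → List (Subset n)
allSubsets = allVecs (inside ∷ outside ∷ [])

bicolorings : (n k : ℕ) → List (Bicoloring n)
bicolorings n k = filter (isBicoloring? k) (allVecs (Sign.+ ∷ Sign.- ∷ []) n)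

minSUR : {n : ℕ} → ℕ → List (Bicoloring n) → ℕ ⁺
minSUR {n} r 𝓑 =
  minimum (map (λ 𝓐 → [ length 𝓐 ]) (filter (uniformSUR? r 𝓑) (sublists (allSubsets n))))

γ : (n k r : ℕ) → ℕ ⁺
γ n k r = maximum (map (minSUR r) (sublists (bicolorings n k)))

{-# OPTIONS --safe #-}

-- Let 𝓐 be a family of m sets of size 2c and regard the incidence vectors of
-- the n points as columns in 𝔽₂^m. If some k columns sum to zero, then the
-- set K of their indices meets every A ∈ 𝓐 in an even number of points,
-- whereas an unbiased representative of the bicoloring of K meets K in exactly
-- c points, and c is odd. So it suffices to find k columns with sum zero.
--
-- For n ≥ 4m + 3 there are at most 2m disjoint pairs of columns whose
-- differences span all differences of columns. Choose the first column of each
-- pair and fill up to k columns with unpaired ones. As k is even, the sum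
-- is a sum of differences, hence the sum of the differences of some of the
-- pairs; switching to the second column in these pairs makes the sum zero.
-- This also needs 2m ≤ k and k + 2m ≤ n; all three inequalities hold if m < ½εn.

module Submission where

open import Defs
open import Algebra.Bundles using (CommutativeMonoid)
import Algebra.Properties.CommutativeSemigroup as CommutativeSemigroupProperties
open import Data.Bool.Base using (Bool; true; false; if_then_else_; not; _xor_)
open import Data.Bool.Properties using (xor-assoc; xor-comm; xor-identityˡ; xor-identityʳ; xor-same)
import Data.Bool.Properties as Bool
open import Data.Fin.Base using (Fin)
open import Data.Fin.Subset using (Subset; ∣_∣)
open import Data.Integer.Base using (+_; -1ℤ; 0ℤ; 1ℤ)
import Data.Integer.Base as ℤ
import Data.Integer.Properties as ℤ
import Data.Integer.Solver as ℤ
open import Data.List.Base using (List; []; _∷_; _++_; length; map; filter; foldr; take; drop)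
import Data.List.Properties as List
open import Data.List.Membership.Propositional using (_∈_; find)
open import Data.List.Membership.Propositional.Properties
  using (∈-∃++; ∈-++⁺ˡ; ∈-++⁺ʳ; ∈-++⁻; ∈-map⁺; ∈-map⁻; ∈-filter⁺; ∈-filter⁻; ∈-cartesianProductWith⁺)
open import Data.List.Relation.Binary.Permutation.Propositional
  using (_↭_; ↭-refl; ↭-sym; ↭-trans; ↭-reflexive; prep; swap)
import Data.List.Relation.Binary.Permutation.Propositional as Perm
open import Data.List.Relation.Binary.Permutation.Propositional.Properties
  using (↭-length; ∈-resp-↭; shift; shifts; drop-∷; ++⁺ˡ; ++⁺ʳ)
open import Data.List.Relation.Unary.All using (All; []; _∷_; all?)
import Data.List.Relation.Unary.All as All
open import Data.List.Relation.Unary.All.Properties using (¬All⇒Any¬)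
open import Data.List.Relation.Unary.Any using (here; there)
open import Data.Nat using (ℕ; zero; suc; _+_; _*_; _∸_; _≤_; _<_; z≤n; s≤s)
open import Data.Nat.Divisibility using (_∣_; divides)
import Data.Nat.Properties as ℕ
open import Data.Nat.Solver using (module +-*-Solver)
open import Data.Product using (Σ-syntax; ∃-syntax; _×_; _,_; proj₁; proj₂)
open import Data.Rational using (ℚ; 0ℚ; ½)
import Data.Rational.Base as ℚ
import Data.Rational.Properties as ℚ
import Data.Rational.Unnormalised.Base as ℚᵘ
import Data.Rational.Unnormalised.Properties as ℚᵘ
import Data.Sign.Base as Sign
import Data.Sign.Properties as Sign
open import Data.Sum using (_⊎_; inj₁; inj₂; [_,_]′)
open import Data.Unit.Base using (tt)
open import Data.Vec.Base using (Vec; []; _∷_; head; tail; zipWith; replicate; toList; lookup; count; allFin)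
import Data.Vec.Base as Vec
import Data.Vec.Properties as Vec
open import Relation.Nullary using (¬_; yes; no; contradiction)
open import Relation.Nullary.Construct.Add.Supremum using (_⁺; [_]; ⊤⁺)
open import Relation.Binary.PropositionalEquality
  using (_≡_; _≢_; refl; sym; trans; cong; cong₂; subst; isEquivalence; module ≡-Reasoning)

private
  variable
    m n : ℕ
    C : Set

-- Linear algebra over 𝔽₂: vectors, spans, and quotients by one vector.

infixl 6 _⊕_

_⊕_ : Vec Bool m → Vec Bool m → Vec Bool m
_⊕_ = zipWith _xor_

𝟎 : Vec Bool m
𝟎 = replicate _ false

⊕-commutativeMonoid : ℕ → CommutativeMonoid _ _
⊕-commutativeMonoid m = record
  { Carrier = Vec Bool m
  ; _≈_ = _≡_
  ; _∙_ = _⊕_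
  ; ε = 𝟎
  ; isCommutativeMonoid = record
    { isMonoid = record
      { isSemigroup = record
        { isMagma = record { isEquivalence = isEquivalence ; ∙-cong = cong₂ _⊕_ }
        ; assoc = Vec.zipWith-assoc xor-assoc
        }
      ; identity = Vec.zipWith-identityˡ xor-identityˡ , Vec.zipWith-identityʳ xor-identityʳ
      }
    ; comm = Vec.zipWith-comm xor-comm
    }
  }

module _ {m : ℕ} where
  open CommutativeMonoid (⊕-commutativeMonoid m) public
    using ()
    renaming (assoc to ⊕-assoc; comm to ⊕-comm; identityˡ to ⊕-identityˡ; identityʳ to ⊕-identityʳ)
  open CommutativeSemigroupProperties
    (CommutativeMonoid.commutativeSemigroup (⊕-commutativeMonoid m)) public
    using () renaming (interchange to ⊕-interchange; x∙yz≈y∙xz to x⊕yz≡y⊕xz)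

⊕-self : (x : Vec Bool m) → x ⊕ x ≡ 𝟎
⊕-self []       = refl
⊕-self (x ∷ xs) = cong₂ _∷_ (xor-same x) (⊕-self xs)

⊕-cancelˡ : (x y : Vec Bool m) → x ⊕ (x ⊕ y) ≡ y
⊕-cancelˡ x y = begin
  x ⊕ (x ⊕ y)  ≡⟨ ⊕-assoc x x y ⟨
  x ⊕ x ⊕ y    ≡⟨ cong (_⊕ y) (⊕-self x) ⟩
  𝟎 ⊕ y        ≡⟨ ⊕-identityˡ y ⟩
  y            ∎
  where open ≡-Reasoning

⊕-telescope : (x y z : Vec Bool m) → (x ⊕ y) ⊕ (y ⊕ z) ≡ x ⊕ z
⊕-telescope x y z = trans (⊕-assoc x y (y ⊕ z)) (cong (x ⊕_) (⊕-cancelˡ y z))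

-- A derivation records for each entry of the list whether it is used; it is a choice of a sublist
-- and not mere membership in a subspace. `transversal` reads it as the set of pairs to switch.
data Span {m : ℕ} : List (Vec Bool m) → Vec Bool m → Set where
  []   : Span [] 𝟎
  skip : ∀ {d ds v} → Span ds v → Span (d ∷ ds) v
  add  : ∀ {d ds v} → Span ds v → Span (d ∷ ds) (d ⊕ v)

span-𝟎 : (ds : List (Vec Bool m)) → Span ds 𝟎
span-𝟎 []       = []
span-𝟎 (d ∷ ds) = skip (span-𝟎 ds)

span-here : ∀ {d : Vec Bool m} {ds} → Span (d ∷ ds) d
span-here {d = d} {ds} = subst (Span (d ∷ ds)) (⊕-identityʳ d) (add (span-𝟎 ds))

-- When both derivations use `d`, the two copies cancel and the derivation of the sum skips `d`.
span-⊕ : ∀ {ds} {v w : Vec Bool m} → Span ds v → Span ds w → Span ds (v ⊕ w)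
span-⊕ []       []       = subst (Span []) (sym (⊕-self 𝟎)) []
span-⊕ (skip p) (skip q) = skip (span-⊕ p q)
span-⊕ (skip p) (add {d} {_} {w} q) =
  subst (Span _) (x⊕yz≡y⊕xz d _ w) (add (span-⊕ p q))
span-⊕ (add {d} {_} {v} p) (skip q) =
  subst (Span _) (sym (⊕-assoc d v _)) (add (span-⊕ p q))
span-⊕ (add {d} {_} {v} p) (add {_} {_} {w} q) =
  subst (Span _) eq (skip (span-⊕ p q))
  where
  eq : v ⊕ w ≡ (d ⊕ v) ⊕ (d ⊕ w)
  eq = begin
    v ⊕ w              ≡⟨ ⊕-telescope v d w ⟨
    (v ⊕ d) ⊕ (d ⊕ w)  ≡⟨ cong (_⊕ (d ⊕ w)) (⊕-comm v d) ⟩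
    (d ⊕ v) ⊕ (d ⊕ w)  ∎
    where open ≡-Reasoning

-- The quotient of 𝔽₂^(1+m) by a vector d with leading coordinate 1.
reduce : Vec Bool (suc m) → Vec Bool (suc m) → Vec Bool m
reduce d (b ∷ v) = if b then tail d ⊕ v else v

reduce-⊕ : (d v w : Vec Bool (suc m)) → reduce d (v ⊕ w) ≡ reduce d v ⊕ reduce d w
reduce-⊕ d (false ∷ v) (false ∷ w) = refl
reduce-⊕ d (false ∷ v) (true  ∷ w) = x⊕yz≡y⊕xz (tail d) v w
reduce-⊕ d (true  ∷ v) (false ∷ w) = sym (⊕-assoc (tail d) v w)
reduce-⊕ d (true  ∷ v) (true  ∷ w) = begin
  v ⊕ w                            ≡⟨ ⊕-telescope v (tail d) w ⟨
  (v ⊕ tail d) ⊕ (tail d ⊕ w)      ≡⟨ cong (_⊕ (tail d ⊕ w)) (⊕-comm v (tail d)) ⟩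
  (tail d ⊕ v) ⊕ (tail d ⊕ w)      ∎
  where open ≡-Reasoning

-- Since `d` has leading coordinate 1, the kernel of `reduce d` consists of `𝟎` and `d` only.
reduce-injective : ∀ (d v w : Vec Bool (suc m)) → head d ≡ true →
  reduce d v ≡ reduce d w → v ≡ w ⊎ v ≡ d ⊕ w
reduce-injective (true ∷ d) (false ∷ v) (false ∷ w) refl eq = inj₁ (cong (false ∷_) eq)
reduce-injective (true ∷ d) (false ∷ v) (true  ∷ w) refl eq = inj₂ (cong (false ∷_) eq)
reduce-injective (true ∷ d) (true  ∷ v) (false ∷ w) refl eq =
  inj₂ (cong (true ∷_) (trans (sym (⊕-cancelˡ d v)) (cong (d ⊕_) eq)))
reduce-injective (true ∷ d) (true  ∷ v) (true  ∷ w) refl eq =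
  inj₁ (cong (true ∷_) (trans (sym (⊕-cancelˡ d v)) (trans (cong (d ⊕_) eq) (⊕-cancelˡ d w))))

-- Few disjoint pairs whose differences span all differences.

points : List (C × C) → List C
points []            = []
points ((x , y) ∷ P) = x ∷ y ∷ points P

length-points : (P : List (C × C)) → length (points P) ≡ length P + length P
length-points []      = refl
length-points (_ ∷ P) =
  cong suc (trans (cong suc (length-points P)) (sym (ℕ.+-suc (length P) (length P))))

differences : (C → Vec Bool m) → List (C × C) → List (Vec Bool m)
differences h = map λ (x , y) → h x ⊕ h y

-- By linearity of `reduce d`, the same coefficients can be used on the original differences.
span-reduce : ∀ d (h : C → Vec Bool (suc m)) P {v} →
  Span (differences (λ c → reduce d (h c)) P) v → ∃[ w ] Span (differences h P) w × reduce d w ≡ v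
span-reduce d h []            [] = 𝟎 , [] , refl
span-reduce d h ((x , y) ∷ P) (skip s) =
  let w , s′ , eq = span-reduce d h P s in w , skip s′ , eq
span-reduce d h ((x , y) ∷ P) (add s) =
  let w , s′ , eq = span-reduce d h P s in
  h x ⊕ h y ⊕ w , add s′ ,
  trans (reduce-⊕ d (h x ⊕ h y) w) (cong₂ _⊕_ (reduce-⊕ d (h x) (h y)) eq)

-- A leading coordinate shared by all points cancels in every difference, so dropping it loses
-- nothing.
span-tail : ∀ b (h : C → Vec Bool (suc m)) P {v} → All (λ c → head (h c) ≡ b) (points P) →
  Span (differences (λ c → tail (h c)) P) v → Span (differences h P) (false ∷ v)
span-tail b h []            _ [] = []
span-tail b h ((x , y) ∷ P) (_  ∷ _  ∷ hs) (skip s) = skip (span-tail b h P hs s)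
span-tail b h ((x , y) ∷ P) (hx ∷ hy ∷ hs) (add {_} {_} {v} s) =
  subst (Span _) eq (add (span-tail b h P hs s))
  where
  eq : h x ⊕ h y ⊕ (false ∷ v) ≡ false ∷ (tail (h x) ⊕ tail (h y) ⊕ v)
  eq with h x | h y
  eq | p ∷ ps | q ∷ qs = cong (_∷ (ps ⊕ qs ⊕ v)) (begin
    (p xor q) xor false  ≡⟨ xor-identityʳ (p xor q) ⟩
    p xor q              ≡⟨ cong₂ _xor_ hx hy ⟩
    b xor b              ≡⟨ xor-same b ⟩
    false                ∎)
    where open ≡-Reasoning

-- Disjointness of the pairs is encoded in `split`, which uses each entry of `L` exactly once.
-- `spans` covers the unpaired points too.
record Pairing (h : C → Vec Bool m) (L : List C) (s : ℕ) : Set where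
  field
    pairs : List (C × C)
    rest  : List C
    split : L ↭ points pairs ++ rest
    few   : length pairs ≤ s
    spans : ∀ {x y} → x ∈ L → y ∈ L → Span (differences h pairs) (h x ⊕ h y)

module _ (h : C → Vec Bool m) {L : List C} {s : ℕ} where

  pairing-resp-↭ : ∀ {L′} → L ↭ L′ → Pairing h L s → Pairing h L′ s
  pairing-resp-↭ σ p = record
    { pairs = pairs
    ; rest  = rest
    ; split = ↭-trans (↭-sym σ) split
    ; few   = few
    ; spans = λ x∈ y∈ → spans (∈-resp-↭ (↭-sym σ) x∈) (∈-resp-↭ (↭-sym σ) y∈)
    }
    where open Pairing p

pairing-tail : ∀ b (h : C → Vec Bool (suc m)) {L s} → All (λ c → head (h c) ≡ b) L →
  Pairing (λ c → tail (h c)) L s → Pairing h L s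
pairing-tail b h {L} heads p = record
  { pairs = pairs
  ; rest  = rest
  ; split = split
  ; few   = few
  ; spans = λ {x} {y} x∈ y∈ → subst (Span _)
      (eq (h x) (h y) (All.lookup heads x∈) (All.lookup heads y∈))
      (span-tail b h pairs headsP (spans x∈ y∈))
  }
  where
  open Pairing p
  headsP : All (λ c → head (h c) ≡ b) (points pairs)
  headsP = All.tabulate λ x∈ → All.lookup heads (∈-resp-↭ (↭-sym split) (∈-++⁺ˡ x∈))
  eq : ∀ (v w : Vec Bool (suc _)) → head v ≡ b → head w ≡ b →
       false ∷ (tail v ⊕ tail w) ≡ v ⊕ w
  eq (_ ∷ v) (_ ∷ w) refl refl = cong (_∷ (v ⊕ w)) (sym (xor-same b))

-- The old pairs span everything modulo `d`, so only `d` itself is missing. Pairing `a` and `b` with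
-- two unpaired points that agree modulo the old span recovers it: the two new differences add up to
-- `d` plus an element of the old span.
pairing-reduce : ∀ (h : C → Vec Bool (suc m)) a b {L s} → head (h a ⊕ h b) ≡ true →
  s + s + 3 ≤ length L →
  Pairing (λ c → reduce (h a ⊕ h b) (h c)) L s → Pairing h (a ∷ b ∷ L) (2 + s)
pairing-reduce {C = C} h a b {L} {s} d₁ big p = go rest refl three
  where
  open Pairing p
  d = h a ⊕ h b

  _∼_ : C → C → Set
  x ∼ y = Span (differences h pairs) (h x ⊕ h y)

  -- A vector is determined by its image under `reduce d` only up to `d`, hence the two
  -- alternatives.
  near : ∀ {x y} → x ∈ L → y ∈ L → x ∼ y ⊎ Span (differences h pairs) (d ⊕ (h x ⊕ h y))
  near {x} {y} x∈ y∈ =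
    let w , sw , eq = span-reduce d h pairs (spans x∈ y∈)
    in [ (λ e → inj₁ (subst (Span _) e sw)) , (λ e → inj₂ (subst (Span _) e sw)) ]′
       (reduce-injective d w (h x ⊕ h y) d₁ (trans eq (sym (reduce-⊕ d (h x) (h y)))))

  -- At most `s` pairs occupy at most `s + s` points; the surplus of 3 feeds the pigeonhole argument
  -- in `go`.
  three : 3 ≤ length rest
  three = ℕ.+-cancelˡ-≤ (s + s) 3 (length rest) (begin
    s + s + 3                                     ≤⟨ big ⟩
    length L                                      ≡⟨ ↭-length split ⟩
    length (points pairs ++ rest)                 ≡⟨ List.length-++ (points pairs) ⟩
    length (points pairs) + length rest           ≡⟨ cong (_+ length rest) (length-points pairs) ⟩
    length pairs + length pairs + length rest     ≤⟨ ℕ.+-monoˡ-≤ (length rest) (ℕ.+-mono-≤ few few) ⟩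
    s + s + length rest                           ∎)
    where open ℕ.≤-Reasoning

  build : ∀ r r′ R → L ↭ points pairs ++ r ∷ r′ ∷ R → r ∼ r′ → Pairing h (a ∷ b ∷ L) (2 + s)
  build r r′ R σ r∼r′ = record
    { pairs = P
    ; rest  = R
    ; split = ↭-trans (prep a (prep b (↭-trans σ (shifts (points pairs) (r ∷ r′ ∷ [])))))
                      (prep a (swap b r ↭-refl))
    ; few   = s≤s (s≤s few)
    ; spans = λ {x} {y} x∈ y∈ → subst (Span _) (⊕-telescope (h x) (h r) (h y))
        (span-⊕ (toR x∈) (subst (Span _) (⊕-comm (h y) (h r)) (toR y∈)))
    }
    where
    P = (a , r) ∷ (b , r′) ∷ pairs
    a∼r : Span (differences h P) (h a ⊕ h r)
    a∼r = span-here
    b∼r : Span (differences h P) (h b ⊕ h r)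
    b∼r = subst (Span _) (⊕-telescope (h b) (h r′) (h r))
      (span-⊕ (skip span-here) (skip (skip (subst (Span _) (⊕-comm (h r) (h r′)) r∼r′))))
    d∈ : Span (differences h P) d
    d∈ = subst (Span _) (⊕-telescope (h a) (h r) (h b))
      (span-⊕ a∼r (subst (Span _) (⊕-comm (h b) (h r)) b∼r))
    r∈ : r ∈ L
    r∈ = ∈-resp-↭ (↭-sym σ) (∈-++⁺ʳ (points pairs) (here refl))
    toR : ∀ {x} → x ∈ a ∷ b ∷ L → Span (differences h P) (h x ⊕ h r)
    toR (here refl)         = a∼r
    toR (there (here refl)) = b∼r
    toR {x} (there (there x∈)) with near x∈ r∈
    ... | inj₁ q = skip (skip q)
    ... | inj₂ q = subst (Span _) (⊕-cancelˡ d (h x ⊕ h r)) (span-⊕ d∈ (skip (skip q)))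

  -- Among three points two are congruent modulo the old span, since d has order 2.
  go : ∀ R → rest ≡ R → 3 ≤ length R → Pairing h (a ∷ b ∷ L) (2 + s)
  go (_ ∷ [])     _ (s≤s ())
  go (_ ∷ _ ∷ []) _ (s≤s (s≤s ()))
  go (r ∷ r′ ∷ r″ ∷ R) refl _ with near (in-rest (here refl)) (in-rest (there (here refl)))
                           | near (in-rest (there (here refl))) (in-rest (there (there (here refl))))
    where
    in-rest : ∀ {x} → x ∈ rest → x ∈ L
    in-rest x∈ = ∈-resp-↭ (↭-sym split) (∈-++⁺ʳ (points pairs) x∈)
  ... | inj₁ q | _      = build r r′ (r″ ∷ R) split q
  ... | inj₂ _ | inj₁ q =
    build r′ r″ (r ∷ R)
      (↭-trans split (++⁺ˡ (points pairs) (Perm.trans (swap r r′ ↭-refl) (prep r′ (swap r r″ ↭-refl))))) q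
  ... | inj₂ p′ | inj₂ q =
    build r r″ (r′ ∷ R)
      (↭-trans split (++⁺ˡ (points pairs) (prep r (swap r′ r″ ↭-refl))))
      (subst (Span _) eq (span-⊕ p′ q))
    where
    open ≡-Reasoning
    eq : (d ⊕ (h r ⊕ h r′)) ⊕ (d ⊕ (h r′ ⊕ h r″)) ≡ h r ⊕ h r″
    eq = begin
      (d ⊕ (h r ⊕ h r′)) ⊕ (d ⊕ (h r′ ⊕ h r″))
        ≡⟨ ⊕-interchange d (h r ⊕ h r′) d (h r′ ⊕ h r″) ⟩
      (d ⊕ d) ⊕ ((h r ⊕ h r′) ⊕ (h r′ ⊕ h r″))
        ≡⟨ cong₂ _⊕_ (⊕-self d) (⊕-telescope (h r) (h r′) (h r″)) ⟩
      𝟎 ⊕ (h r ⊕ h r″)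
        ≡⟨ ⊕-identityˡ (h r ⊕ h r″) ⟩
      h r ⊕ h r″ ∎

-- Induction on the dimension: a leading coordinate constant on all points is dropped; otherwise `a`
-- and some `b` differ in it, and their difference is factored out at the cost of two more pairs.
-- The `2 * m` pairs of the recursive call and three spare points account for `4 * m + 3`.
pairing : ∀ m (h : C → Vec Bool m) L → 4 * m + 3 ≤ length L → Pairing h L (2 * m)
pairing zero h L _ = record
  { pairs = []
  ; rest  = L
  ; split = ↭-refl
  ; few   = z≤n
  ; spans = λ {x} {y} _ _ → empty (h x ⊕ h y)
  }
  where
  empty : (v : Vec Bool 0) → Span [] v
  empty [] = []
pairing (suc m) h (a ∷ L) big with all? (λ c → head (h c) Bool.≟ head (h a)) L
... | yes heads = weaken (pairing-tail (head (h a)) h (refl ∷ heads)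
                    (pairing m (λ c → tail (h c)) (a ∷ L)
                      (ℕ.≤-trans (ℕ.+-monoˡ-≤ 3 (ℕ.*-monoʳ-≤ 4 (ℕ.n≤1+n m))) big)))
  where
  weaken : Pairing h (a ∷ L) (2 * m) → Pairing h (a ∷ L) (2 * suc m)
  weaken p = record
    { pairs = pairs
    ; rest  = rest
    ; split = split
    ; few   = ℕ.≤-trans few (ℕ.*-monoʳ-≤ 2 (ℕ.n≤1+n m))
    ; spans = spans
    }
    where open Pairing p
... | no ¬heads = pairing-resp-↭ h (prep a (↭-sym σ))
      (subst (Pairing h (a ∷ b ∷ L′)) (sym (ℕ.*-suc 2 m))
        (pairing-reduce h a b d₁ big″ (pairing m _ L′ big′)))
  where
  different = find (¬All⇒Any¬ (λ c → head (h c) Bool.≟ head (h a)) L ¬heads)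
  b = proj₁ different
  ys,zs = ∈-∃++ (proj₁ (proj₂ different))
  L′ = proj₁ ys,zs ++ proj₁ (proj₂ ys,zs)
  σ : L ↭ b ∷ L′
  σ = ↭-trans (↭-reflexive (proj₂ (proj₂ ys,zs))) (shift b (proj₁ ys,zs) _)
  xor-≢ : ∀ p q → q ≢ p → p xor q ≡ true
  xor-≢ false false q≢p = contradiction refl q≢p
  xor-≢ false true  q≢p = refl
  xor-≢ true  false q≢p = refl
  xor-≢ true  true  q≢p = contradiction refl q≢p
  head-⊕ : ∀ {k} (v w : Vec Bool (suc k)) → head (v ⊕ w) ≡ head v xor head w
  head-⊕ (_ ∷ _) (_ ∷ _) = refl
  d₁ : head (h a ⊕ h b) ≡ true
  d₁ = trans (head-⊕ (h a) (h b)) (xor-≢ _ _ (proj₂ (proj₂ different)))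
  -- The bound grows by four from `m` to `suc m` and only `a` and `b` are removed, so two entries
  -- are to spare.
  bigger : 4 * m + 5 ≤ length L′
  bigger = ℕ.+-cancelˡ-≤ 2 _ _ (begin
    2 + (4 * m + 5)  ≡⟨ solve 1 (λ m → con 2 :+ (con 4 :* m :+ con 5) := con 4 :* (con 1 :+ m) :+ con 3) refl m ⟩
    4 * suc m + 3    ≤⟨ big ⟩
    suc (length L)   ≡⟨ cong suc (↭-length σ) ⟩
    2 + length L′    ∎)
    where
    open ℕ.≤-Reasoning
    open +-*-Solver
  big′ : 4 * m + 3 ≤ length L′
  big′ = ℕ.≤-trans (ℕ.+-monoʳ-≤ (4 * m) (ℕ.m≤m+n 3 2)) bigger
  big″ : 2 * m + 2 * m + 3 ≤ length L′
  big″ = subst (λ t → t + 3 ≤ length L′) (solve 1 (λ m → con 4 :* m := con 2 :* m :+ con 2 :* m) refl m) big′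
    where open +-*-Solver

-- Zero-sum selections of a prescribed even size.

∑ : (C → Vec Bool m) → List C → Vec Bool m
∑ h = foldr (λ c v → h c ⊕ v) 𝟎

∑-++ : (h : C → Vec Bool m) (K K′ : List C) → ∑ h (K ++ K′) ≡ ∑ h K ⊕ ∑ h K′
∑-++ h []      K′ = sym (⊕-identityˡ (∑ h K′))
∑-++ h (x ∷ K) K′ = trans (cong (h x ⊕_) (∑-++ h K K′)) (sym (⊕-assoc (h x) _ _))

∑-↭ : (h : C → Vec Bool m) {K K′ : List C} → K ↭ K′ → ∑ h K ≡ ∑ h K′
∑-↭ h Perm.refl         = refl
∑-↭ h (prep x σ)        = cong (h x ⊕_) (∑-↭ h σ)
∑-↭ h (swap x y σ)      =
  trans (cong (λ v → h x ⊕ (h y ⊕ v)) (∑-↭ h σ)) (x⊕yz≡y⊕xz (h x) (h y) _)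
∑-↭ h (Perm.trans σ τ)  = trans (∑-↭ h σ) (∑-↭ h τ)

-- The derivation decides pair by pair: `skip` keeps the first point, `add` switches to the second
-- and thereby adds the difference of the pair to the sum.
transversal : ∀ (h : C → Vec Bool m) P {v} → Span (differences h P) v →
  ∃[ K ] ∃[ K′ ] points P ↭ K ++ K′ × length K ≡ length P × ∑ h K ≡ ∑ h (map proj₁ P) ⊕ v
transversal h [] [] = [] , [] , ↭-refl , refl , sym (⊕-self 𝟎)
transversal h ((x , y) ∷ P) (skip {v = v} s) =
  let K , K′ , σ , len , eq = transversal h P s in
  x ∷ K , y ∷ K′ ,
  prep x (↭-trans (prep y σ) (↭-sym (shift y K K′))) ,
  cong suc len ,
  trans (cong (h x ⊕_) eq) (sym (⊕-assoc (h x) (∑ h (map proj₁ P)) v))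
transversal h ((x , y) ∷ P) (add {v = v} s) =
  let K , K′ , σ , len , eq = transversal h P s in
  y ∷ K , x ∷ K′ ,
  ↭-trans (swap x y σ) (prep y (↭-sym (shift x K K′))) ,
  cong suc len ,
  trans (cong (h y ⊕_) eq) (exchange (∑ h (map proj₁ P)))
  where
  open ≡-Reasoning
  exchange : ∀ S → h y ⊕ (S ⊕ v) ≡ (h x ⊕ S) ⊕ (h x ⊕ h y ⊕ v)
  exchange S = begin
    h y ⊕ (S ⊕ v)                  ≡⟨ x⊕yz≡y⊕xz (h y) S v ⟩
    S ⊕ (h y ⊕ v)                  ≡⟨ ⊕-telescope S (h x) (h y ⊕ v) ⟨
    (S ⊕ h x) ⊕ (h x ⊕ (h y ⊕ v))  ≡⟨ cong₂ _⊕_ (⊕-comm S (h x)) (sym (⊕-assoc (h x) (h y) v)) ⟩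
    (h x ⊕ S) ⊕ (h x ⊕ h y ⊕ v)    ∎

-- Over 𝔽₂ the sum of two consecutive entries is their difference, so a list of even length breaks
-- up into spanned summands.
∑-even∈span : ∀ (h : C → Vec Bool m) {ds} j K → length K ≡ j * 2 →
  (∀ {x y} → x ∈ K → y ∈ K → Span ds (h x ⊕ h y)) → Span ds (∑ h K)
∑-even∈span h zero    []          refl _  = span-𝟎 _
∑-even∈span h (suc j) (x ∷ y ∷ K) len  sp =
  subst (Span _) (⊕-assoc (h x) (h y) (∑ h K))
    (span-⊕ (sp (here refl) (there (here refl)))
      (∑-even∈span h j K (ℕ.suc-injective (ℕ.suc-injective len))
        λ x∈ y∈ → sp (there (there x∈)) (there (there y∈))))

map-proj₁⊆points : ∀ (P : List (C × C)) {x} → x ∈ map proj₁ P → x ∈ points P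
map-proj₁⊆points (_ ∷ P) (here refl) = here refl
map-proj₁⊆points (_ ∷ P) (there x∈)  = there (there (map-proj₁⊆points P x∈))

-- Start from the first points of all pairs together with enough unpaired points;
-- exchanging first for second points in some of the pairs then kills the sum.
zero-sum : ∀ (h : C → Vec Bool m) {L s k} → Pairing h L s → 2 ∣ k → s ≤ k → k + s ≤ length L →
  ∃[ K ] ∃[ R ] L ↭ K ++ R × length K ≡ k × ∑ h K ≡ 𝟎
zero-sum h {L} {s} {k} p (divides j k≡j*2) s≤k k+s≤∣L∣ =
  -- The correction is `∑ h K₀` itself: it turns the sum `S` over the first points into
  -- `S ⊕ ∑ h K₀`, that is `∑ h T`, which cancels the sum over `T`.
  let K , K′ , σ , len , eq = transversal h pairs ∑K₀∈span in
  K ++ T , K′ ++ drop t rest ,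
  ↭-trans split (↭-trans (++⁺ʳ rest σ) (regroup K K′)) ,
  trans (List.length-++ K) (trans (cong₂ _+_ len refl) size) ,
  sum-zero K eq
  where
  open Pairing p
  t  = k ∸ length pairs
  T  = take t rest
  K₀ = map proj₁ pairs ++ T
  S  = ∑ h (map proj₁ pairs)

  -- Each pair occupies two points but contributes one, so `rest` has to supply `k` minus the number
  -- of pairs.
  t≤∣rest∣ : t ≤ length rest
  t≤∣rest∣ = ℕ.m≤n+o⇒m∸n≤o k (length pairs) (ℕ.+-cancelˡ-≤ (length pairs) k _ (begin
    length pairs + k                                ≡⟨ ℕ.+-comm (length pairs) k ⟩
    k + length pairs                                ≤⟨ ℕ.+-monoʳ-≤ k few ⟩
    k + s                                           ≤⟨ k+s≤∣L∣ ⟩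
    length L                                        ≡⟨ ↭-length split ⟩
    length (points pairs ++ rest)                   ≡⟨ List.length-++ (points pairs) ⟩
    length (points pairs) + length rest             ≡⟨ cong (_+ length rest) (length-points pairs) ⟩
    length pairs + length pairs + length rest       ≡⟨ ℕ.+-assoc (length pairs) (length pairs) (length rest) ⟩
    length pairs + (length pairs + length rest)     ∎))
    where
    open ℕ.≤-Reasoning

  size : length pairs + length T ≡ k
  size = begin
    length pairs + length T  ≡⟨ cong (λ l → length pairs + l) (trans (List.length-take t rest) (ℕ.m≤n⇒m⊓n≡m t≤∣rest∣)) ⟩
    length pairs + t         ≡⟨ ℕ.m+[n∸m]≡n (ℕ.≤-trans few s≤k) ⟩
    k                        ∎
    where open ≡-Reasoning

  K₀⊆L : ∀ {x} → x ∈ K₀ → x ∈ L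
  K₀⊆L x∈ = ∈-resp-↭ (↭-sym split) ([ (λ x∈P → ∈-++⁺ˡ (map-proj₁⊆points pairs x∈P))
    , (λ x∈T → ∈-++⁺ʳ (points pairs) (subst (_ ∈_) (List.take++drop≡id t rest) (∈-++⁺ˡ x∈T))) ]′
    (∈-++⁻ (map proj₁ pairs) x∈))

  ∑K₀∈span : Span (differences h pairs) (∑ h K₀)
  ∑K₀∈span = ∑-even∈span h j K₀
    (begin
      length K₀                                 ≡⟨ List.length-++ (map proj₁ pairs) ⟩
      length (map proj₁ pairs) + length T       ≡⟨ cong (_+ length T) (List.length-map proj₁ pairs) ⟩
      length pairs + length T                   ≡⟨ size ⟩
      k                                         ≡⟨ k≡j*2 ⟩
      j * 2                                     ∎)
    (λ x∈ y∈ → spans (K₀⊆L x∈) (K₀⊆L y∈))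
    where open ≡-Reasoning

  sum-zero : ∀ K → ∑ h K ≡ S ⊕ ∑ h K₀ → ∑ h (K ++ T) ≡ 𝟎
  sum-zero K eq = begin
    ∑ h (K ++ T)                 ≡⟨ ∑-++ h K T ⟩
    ∑ h K ⊕ ∑ h T                ≡⟨ cong (_⊕ ∑ h T) eq ⟩
    S ⊕ ∑ h K₀ ⊕ ∑ h T           ≡⟨ cong (_⊕ ∑ h T) (cong (S ⊕_) (∑-++ h (map proj₁ pairs) T)) ⟩
    S ⊕ (S ⊕ ∑ h T) ⊕ ∑ h T      ≡⟨ cong (_⊕ ∑ h T) (⊕-cancelˡ S (∑ h T)) ⟩
    ∑ h T ⊕ ∑ h T                ≡⟨ ⊕-self (∑ h T) ⟩
    𝟎                            ∎
    where open ≡-Reasoning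

  regroup : ∀ K K′ → (K ++ K′) ++ rest ↭ (K ++ T) ++ (K′ ++ drop t rest)
  regroup K K′ = ↭-trans (↭-reflexive (trans (List.++-assoc K K′ rest)
        (cong (λ R → K ++ (K′ ++ R)) (sym (List.take++drop≡id t rest)))))
      (↭-trans (++⁺ˡ K (shifts K′ T)) (↭-reflexive (sym (List.++-assoc K T _))))

-- Bicolorings, parities and inner products.

selected : Bicoloring n → Vec C n → List C
selected []           []       = []
selected (Sign.+ ∷ B) (x ∷ xs) = x ∷ selected B xs
selected (Sign.- ∷ B) (x ∷ xs) = selected B xs

length-selected : (B : Bicoloring n) (xs : Vec C n) →
  count (Sign._≟ Sign.+) B ≡ length (selected B xs)
length-selected []           []       = refl
length-selected (Sign.+ ∷ B) (x ∷ xs) = cong suc (length-selected B xs)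
length-selected (Sign.- ∷ B) (x ∷ xs) = length-selected B xs

-- Induction on `xs`: the head occurs in `K` or in `R`, is removed there and gets the corresponding
-- sign. The order of `K` may be lost, but `∑` is invariant under permutations.
select : ∀ (xs : Vec C n) {K R} → toList xs ↭ K ++ R → ∃[ B ] selected B xs ↭ K
select []       {[]}    σ = [] , ↭-refl
select []       {_ ∷ _} σ with () ← ↭-length σ
select (x ∷ xs) {K} {R} σ with ∈-++⁻ K (∈-resp-↭ σ (here refl))
... | inj₁ x∈K with ys , zs , refl ← ∈-∃++ x∈K =
  let B , τ = select xs (drop-∷ (↭-trans σ (++⁺ʳ R (shift x ys zs))))
  in Sign.+ ∷ B , ↭-trans (prep x τ) (↭-sym (shift x ys zs))
... | inj₂ x∈R with ys , zs , refl ← ∈-∃++ x∈R =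
  let B , τ = select xs {K} (drop-∷ (↭-trans σ (↭-trans (++⁺ˡ K (shift x ys zs)) (shift x K _))))
  in Sign.- ∷ B , τ

columns : (𝓐 : List (Subset n)) → Fin n → Vec Bool (length 𝓐)
columns []      j = []
columns (A ∷ 𝓐) j = lookup A j ∷ columns 𝓐 j

parity : Subset n → List (Fin n) → Bool
parity A = foldr (λ j b → lookup A j xor b) false

parity-columns : ∀ (𝓐 : List (Subset n)) K → ∑ (columns 𝓐) K ≡ 𝟎 → All (λ A → parity A K ≡ false) 𝓐
parity-columns []      K eq = []
parity-columns (A ∷ 𝓐) K eq = Vec.∷-injectiveˡ eq′ ∷ parity-columns 𝓐 K (Vec.∷-injectiveʳ eq′)
  where
  rows : ∀ K → ∑ (columns (A ∷ 𝓐)) K ≡ parity A K ∷ ∑ (columns 𝓐) K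
  rows []      = refl
  rows (j ∷ K) = cong (columns (A ∷ 𝓐) j ⊕_) (rows K)
  eq′ = trans (sym (rows K)) eq

hits : Subset n → Bicoloring n → ℕ
hits []          []           = 0
hits (true  ∷ A) (Sign.+ ∷ B) = suc (hits A B)
hits (true  ∷ A) (Sign.- ∷ B) = hits A B
hits (false ∷ A) (_      ∷ B) = hits A B

odd : ℕ → Bool
odd zero    = false
odd (suc n) = not (odd n)

odd⇒2∣ : ∀ n → odd n ≡ false → 2 ∣ n
odd⇒2∣ zero          _  = divides 0 refl
odd⇒2∣ (suc (suc n)) eq with odd n in e | odd⇒2∣ n
... | false | rec with divides q refl ← rec refl = divides (suc q) refl

odd-hits : ∀ (A : Subset n) (B : Bicoloring n) → odd (hits A B) ≡ parity A (selected B (allFin n))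
-- Rewriting `A` as its lookups along `allFin n` permits an induction over arbitrary index vectors
-- in which `parity A` stays fixed.
odd-hits {n} A B = trans (cong (λ A′ → odd (hits A′ B)) (sym (Vec.map-lookup-allFin A))) (lemma B (allFin n))
  where
  lemma : ∀ {l} (B : Bicoloring l) xs →
    odd (hits (Vec.map (lookup A) xs) B) ≡ parity A (selected B xs)
  lemma []           []       = refl
  lemma (Sign.+ ∷ B) (x ∷ xs) with lookup A x
  ... | true  = cong not (lemma B xs)
  ... | false = lemma B xs
  lemma (Sign.- ∷ B) (x ∷ xs) with lookup A x
  ... | true  = lemma B xs
  ... | false = lemma B xs

-- The product is the number of points of `A` colored plus less the number colored minus; these two
-- numbers add up to `∣ A ∣`.
inner-product : ∀ (A : Subset n) (B : Bicoloring n) →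
  ⟨ X A , Y B ⟩ ℤ.+ + ∣ A ∣ ≡ + (hits A B + hits A B)
inner-product [] [] = refl
inner-product (true ∷ A) (Sign.+ ∷ B) = begin
  (1ℤ ℤ.+ i) ℤ.+ (1ℤ ℤ.+ + ∣ A ∣)
    ≡⟨ solve 2 (λ i a → (con 1ℤ :+ i) :+ (con 1ℤ :+ a) := con (+ 2) :+ (i :+ a)) refl i (+ ∣ A ∣) ⟩
  + 2 ℤ.+ (i ℤ.+ + ∣ A ∣)
    ≡⟨ cong (ℤ._+_ (+ 2)) (inner-product A B) ⟩
  + (2 + (hits A B + hits A B))
    ≡⟨ cong (λ t → + suc t) (sym (ℕ.+-suc (hits A B) (hits A B))) ⟩
  + (suc (hits A B) + suc (hits A B)) ∎
  where
  open ≡-Reasoning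
  open ℤ.+-*-Solver
  i = ⟨ X A , Y B ⟩
inner-product (true ∷ A) (Sign.- ∷ B) = trans
  (solve 2 (λ i a → (con -1ℤ :+ i) :+ (con 1ℤ :+ a) := i :+ a) refl ⟨ X A , Y B ⟩ (+ ∣ A ∣))
  (inner-product A B)
  where open ℤ.+-*-Solver
inner-product (false ∷ A) (Sign.+ ∷ B) =
  trans (cong (ℤ._+ + ∣ A ∣) (ℤ.+-identityˡ ⟨ X A , Y B ⟩)) (inner-product A B)
inner-product (false ∷ A) (Sign.- ∷ B) =
  trans (cong (ℤ._+ + ∣ A ∣) (ℤ.+-identityˡ ⟨ X A , Y B ⟩)) (inner-product A B)

unbiased⇒hits : ∀ (A : Subset n) (B : Bicoloring n) {c} → ∣ A ∣ ≡ 2 * c → ⟨ X A , Y B ⟩ ≡ 0ℤ → hits A B ≡ c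
unbiased⇒hits A B {c} ∣A∣≡2c unbiased = ℕ.*-cancelˡ-≡ (hits A B) c 2 (ℤ.+-injective (begin
  + (2 * hits A B)                 ≡⟨ cong (λ t → + (hits A B + t)) (ℕ.+-identityʳ (hits A B)) ⟩
  + (hits A B + hits A B)          ≡⟨ inner-product A B ⟨
  ⟨ X A , Y B ⟩ ℤ.+ + ∣ A ∣        ≡⟨ cong₂ (λ i a → i ℤ.+ + a) unbiased ∣A∣≡2c ⟩
  0ℤ ℤ.+ + (2 * c)                 ≡⟨ ℤ.+-identityˡ (+ (2 * c)) ⟩
  + (2 * c)                        ∎))
  where open ≡-Reasoning

-- Small families are not SURs.

allVecs-complete : ∀ {xs : List C} → (∀ x → x ∈ xs) → (v : Vec C n) → v ∈ allVecs xs n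
allVecs-complete ∈xs []      = here refl
allVecs-complete ∈xs (x ∷ v) = ∈-cartesianProductWith⁺ _∷_ (∈xs x) (allVecs-complete ∈xs v)

bicolorings-complete : ∀ k (B : Bicoloring n) → IsBicoloring k B → B ∈ bicolorings n k
bicolorings-complete k B = ∈-filter⁺ (isBicoloring? k) (allVecs-complete ∈signs B)
  where
  ∈signs : ∀ s → s ∈ Sign.+ ∷ Sign.- ∷ []
  ∈signs Sign.+ = here refl
  ∈signs Sign.- = there (here refl)

small-family-not-SUR : ∀ {c k} (𝓐 : List (Subset n)) → ¬ (2 ∣ c) → 2 ∣ k →
  4 * length 𝓐 + 3 ≤ n → 2 * length 𝓐 ≤ k → k + 2 * length 𝓐 ≤ n →
  Uniform (2 * c) 𝓐 → ¬ SUR (bicolorings n k) 𝓐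
small-family-not-SUR {n} {c} {k} 𝓐 2∤c 2∣k big s≤k k+s≤n uniform sur =
  let K , R , σ , ∣K∣≡k , ∑K≡𝟎 =
        zero-sum h (pairing (length 𝓐) h (toList (allFin n)) (within big))
          2∣k s≤k (within k+s≤n)
      B , τ = select (allFin n) {K} {R} σ
      B∈ = bicolorings-complete k B
        (trans (length-selected B (allFin n)) (trans (↭-length τ) ∣K∣≡k))
      A , A∈𝓐 , _ , unbiased = find (All.lookup sur B∈)
      even = All.lookup (parity-columns 𝓐 (selected B (allFin n)) (trans (∑-↭ h τ) ∑K≡𝟎)) A∈𝓐
      hits≡c = unbiased⇒hits A B (All.lookup uniform A∈𝓐) unbiased
  -- `A` meets the plus points of `B` in exactly `c` points, yet in an even number of them because
  -- the columns sum to zero.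
  in 2∤c (subst (2 ∣_) hits≡c (odd⇒2∣ (hits A B) (trans (odd-hits A B) even)))
  where
  h = columns 𝓐
  ∣L∣≡n : length (toList (allFin n)) ≡ n
  ∣L∣≡n = Vec.length-toList (allFin n)
  within : ∀ {l} → l ≤ n → l ≤ length (toList (allFin n))
  within l≤n = ℕ.≤-trans l≤n (ℕ.≤-reflexive (sym ∣L∣≡n))

-- The embedding of ℕ into ℚ that underlies `fromℕ`.

ι : ℕ → ℚ
ι n = + n ℚ./ 1

toℚᵘ-ι : ∀ n → ℚ.toℚᵘ (ι n) ℚᵘ.≃ ℚᵘ.mkℚᵘ (+ n) 0
toℚᵘ-ι n = ℚ.toℚᵘ-fromℚᵘ (ℚᵘ.mkℚᵘ (+ n) 0)

-- `ι` produces normalised fractions; passing to unnormalised ones with denominator 1 leaves an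
-- identity of integers.
ι-homo-+ : ∀ m n → ι (m + n) ≡ ι m ℚ.+ ι n
ι-homo-+ m n = ℚ.toℚᵘ-injective (begin
  ℚ.toℚᵘ (ι (m + n))                          ≈⟨ toℚᵘ-ι (m + n) ⟩
  ℚᵘ.mkℚᵘ (+ (m + n)) 0                       ≈⟨ ℚᵘ.*≡* (cong (ℤ._* (+ 1))
    (cong₂ ℤ._+_ (sym (ℤ.*-identityʳ (+ m))) (sym (ℤ.*-identityʳ (+ n))))) ⟩
  ℚᵘ.mkℚᵘ (+ m) 0 ℚᵘ.+ ℚᵘ.mkℚᵘ (+ n) 0        ≈⟨ ℚᵘ.+-cong (toℚᵘ-ι m) (toℚᵘ-ι n) ⟨
  ℚ.toℚᵘ (ι m) ℚᵘ.+ ℚ.toℚᵘ (ι n)              ≈⟨ ℚ.toℚᵘ-homo-+ (ι m) (ι n) ⟨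
  ℚ.toℚᵘ (ι m ℚ.+ ι n)                        ∎)
  where open ℚᵘ.≃-Reasoning

ι-mono-≤ : ∀ {m n} → m ≤ n → ι m ℚ.≤ ι n
ι-mono-≤ {m} {n} m≤n = ℚ.toℚᵘ-cancel-≤
  (ℚᵘ.≤-respˡ-≃ (ℚᵘ.≃-sym (toℚᵘ-ι m)) (ℚᵘ.≤-respʳ-≃ (ℚᵘ.≃-sym (toℚᵘ-ι n))
    (ℚᵘ.*≤* (ℤ.*-monoʳ-≤-nonNeg (+ 1) (ℤ.+≤+ m≤n)))))

ι-cancel-< : ∀ {m n} → ι m ℚ.< ι n → m < n
ι-cancel-< {m} {n} ιm<ιn = ℕ.≰⇒> λ n≤m → ℚ.<-irrefl refl (ℚ.<-≤-trans ιm<ιn (ι-mono-≤ n≤m))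

-- Lower bounds for `γ`.

≤⁺-minimum : ∀ x {ys} → All (x ≤⁺_) ys → x ≤⁺ minimum ys
≤⁺-minimum x []                    = tt
≤⁺-minimum x (_∷_ {y} {ys} x≤y x≤ys) = both y (minimum ys) x≤y (≤⁺-minimum x x≤ys)
  where
  both : ∀ y z → x ≤⁺ y → x ≤⁺ z → x ≤⁺ (y ⊓⁺ z)
  both ⊤⁺    z     _   x≤z = x≤z
  both [ a ] ⊤⁺    x≤y _   = x≤y
  both [ a ] [ b ] x≤y x≤z with ℕ.⊓-sel a b
  ... | inj₁ eq = subst (λ t → x ≤ℝ fromℕ t) (sym eq) x≤y
  ... | inj₂ eq = subst (λ t → x ≤ℝ fromℕ t) (sym eq) x≤z

≤ℝ-mono : ∀ x {m n} → m ≤ n → x ≤ℝ fromℕ m → x ≤ℝ fromℕ n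
≤ℝ-mono x m≤n x≤m q 0<q =
  let N , bound = x≤m q 0<q
  in N , λ i N≤i → ℚ.≤-trans (bound i N≤i) (ℚ.+-monoˡ-≤ q (ι-mono-≤ m≤n))

≤⁺-maximum : ∀ x {y ys} → y ∈ ys → x ≤⁺ y → x ≤⁺ maximum ys
≤⁺-maximum x {y} {_ ∷ ys} (here refl) x≤y = left y (maximum ys) x≤y
  where
  left : ∀ y z → x ≤⁺ y → x ≤⁺ (y ⊔⁺ z)
  left ⊤⁺    z     _   = tt
  left [ a ] ⊤⁺    _   = tt
  left [ a ] [ b ] x≤y = ≤ℝ-mono x (ℕ.m≤m⊔n a b) x≤y
≤⁺-maximum x {y} {y′ ∷ ys} (there y∈) x≤y = right y′ (maximum ys) (≤⁺-maximum x y∈ x≤y)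
  where
  right : ∀ y z → x ≤⁺ z → x ≤⁺ (y ⊔⁺ z)
  right ⊤⁺    z     _   = tt
  right [ a ] ⊤⁺    _   = tt
  right [ a ] [ b ] x≤z = ≤ℝ-mono x (ℕ.m≤n⊔m a b) x≤z

sublists-refl : (xs : List C) → xs ∈ sublists xs
sublists-refl []       = here refl
sublists-refl (x ∷ xs) = ∈-++⁺ˡ (∈-map⁺ (x ∷_) (sublists-refl xs))

-- As `γ` is a maximum, bounding its value at one list suffices, and the list of all `k`-bicolorings
-- is among its own sublists. If no SUR exists, the minimum is ∞ and the bound is trivial.
≤⁺-γ : ∀ x n k r →
  (∀ 𝓐 → SUR (bicolorings n k) 𝓐 → Uniform r 𝓐 → x ≤ℝ fromℕ (length 𝓐)) → x ≤⁺ γ n k r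
≤⁺-γ x n k r bound = ≤⁺-maximum x (∈-map⁺ (minSUR r) (sublists-refl (bicolorings n k)))
  (≤⁺-minimum x (All.tabulate λ y∈ → member (∈-map⁻ _ y∈)))
  where
  member : ∀ {y} → ∃[ 𝓐 ] 𝓐 ∈ filter (uniformSUR? r (bicolorings n k)) (sublists (allSubsets n)) ×
           y ≡ [ length 𝓐 ] → x ≤⁺ y
  member (𝓐 , 𝓐∈ , refl) =
    let _ , sur , uniform = ∈-filter⁻ (uniformSUR? r (bicolorings n k)) {xs = sublists (allSubsets n)} 𝓐∈
    in bound 𝓐 sur uniform

-- The choice of δ and the conclusion.

½*q+½*q≡q : ∀ q → ½ ℚ.* q ℚ.+ ½ ℚ.* q ≡ q
½*q+½*q≡q q = trans (sym (ℚ.*-distribʳ-+ q ½ ½)) (ℚ.*-identityˡ q)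

a+p≤b⇒a<b : ∀ {a p b} → 0ℚ ℚ.< p → a ℚ.+ p ℚ.≤ b → a ℚ.< b
a+p≤b⇒a<b {a} {p} {b} 0<p a+p≤b = begin-strict
  a          ≡⟨ ℚ.+-identityʳ a ⟨
  a ℚ.+ 0ℚ   <⟨ ℚ.+-monoʳ-< a 0<p ⟩
  a ℚ.+ p    ≤⟨ a+p≤b ⟩
  b          ∎
  where open ℚ.≤-Reasoning

-- The factor ½ pays for the doubling of `m`.
ι-double-< : ∀ {e q} m n → q ℚ.≤ e → ι m ℚ.< ½ ℚ.* q ℚ.* ι n → ι (2 * m) ℚ.< e ℚ.* ι n
ι-double-< {e} {q} m n q≤e ιm<½qn = begin-strict
  ι (2 * m)                               ≡⟨ cong (λ t → ι (m + t)) (ℕ.+-identityʳ m) ⟩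
  ι (m + m)                               ≡⟨ ι-homo-+ m m ⟩
  ι m ℚ.+ ι m                             <⟨ ℚ.+-mono-< ιm<½qn ιm<½qn ⟩
  ½ ℚ.* q ℚ.* ι n ℚ.+ ½ ℚ.* q ℚ.* ι n     ≡⟨ ℚ.*-distribʳ-+ (ι n) (½ ℚ.* q) (½ ℚ.* q) ⟨
  (½ ℚ.* q ℚ.+ ½ ℚ.* q) ℚ.* ι n           ≡⟨ cong (ℚ._* ι n) (½*q+½*q≡q q) ⟩
  q ℚ.* ι n                               ≤⟨ ℚ.*-monoʳ-≤-nonNeg (ι n) {{ℚ.nonNegative (ι-mono-≤ {0} {n} z≤n)}} q≤e ⟩
  e ℚ.* ι n                               ∎
  where open ℚ.≤-Reasoning

ι-complement-< : ∀ e k l n → ι l ℚ.< e ℚ.* ι n → ι k ℚ.< (ι 1 ℚ.- e) ℚ.* ι n → k + l < n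
ι-complement-< e k l n l<en k<[1-e]n = ι-cancel-< (begin-strict
  ι (k + l)                            ≡⟨ ι-homo-+ k l ⟩
  ι k ℚ.+ ι l                          <⟨ ℚ.+-mono-< k<[1-e]n l<en ⟩
  (ι 1 ℚ.- e) ℚ.* ι n ℚ.+ e ℚ.* ι n    ≡⟨ ℚ.*-distribʳ-+ (ι n) (ι 1 ℚ.- e) e ⟨
  (ι 1 ℚ.- e ℚ.+ e) ℚ.* ι n            ≡⟨ cong (ℚ._* ι n) (ℚ.+-assoc (ι 1) (ℚ.- e) e) ⟩
  (ι 1 ℚ.+ (ℚ.- e ℚ.+ e)) ℚ.* ι n      ≡⟨ cong (λ t → (ι 1 ℚ.+ t) ℚ.* ι n) (ℚ.+-inverseˡ e) ⟩
  ι 1 ℚ.* ι n                          ≡⟨ ℚ.*-identityˡ (ι n) ⟩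
  ι n                                  ∎)
  where open ℚ.≤-Reasoning

-- Both sides are even, so a strict inequality leaves a gap of two.
2*m<k⇒2*[1+m]≤k : ∀ m {k} → 2 ∣ k → 2 * m < k → 2 * suc m ≤ k
2*m<k⇒2*[1+m]≤k m (divides j refl) 2m<k =
  subst (2 * suc m ≤_) (ℕ.*-comm 2 j)
    (ℕ.*-monoʳ-≤ 2 (ℕ.*-cancelˡ-< 2 m j (subst (2 * m <_) (ℕ.*-comm j 2) 2m<k)))

-- The size condition of `pairing` follows from the other two: with m sets, `2 * m + 2 ≤ k` bounds
-- `4 * m + 3` by `k + 2 * m + 1`, which is at most `n`.
few-sets-not-SUR : ∀ {c k} (𝓐 : List (Subset n)) → ¬ (2 ∣ c) → 2 ∣ k →
  2 * length 𝓐 < k → k + 2 * length 𝓐 < n →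
  Uniform (2 * c) 𝓐 → ¬ SUR (bicolorings n k) 𝓐
few-sets-not-SUR {n} {c} {k} 𝓐 2∤c 2∣k 2m<k k+2m<n =
  small-family-not-SUR 𝓐 2∤c 2∣k big (ℕ.<⇒≤ 2m<k) (ℕ.<⇒≤ k+2m<n)
  where
  l = length 𝓐
  open ℕ.≤-Reasoning
  open +-*-Solver
  big : 4 * l + 3 ≤ n
  big = begin
    4 * l + 3                    ≡⟨ solve 1 (λ m → con 4 :* m :+ con 3 := con 1 :+ (con 2 :* (con 1 :+ m) :+ con 2 :* m)) refl l ⟩
    suc (2 * suc l + 2 * l)      ≤⟨ s≤s (ℕ.+-monoˡ-≤ (2 * l) (2*m<k⇒2*[1+m]≤k l 2∣k 2m<k)) ⟩
    suc (k + 2 * l)              ≤⟨ k+2m<n ⟩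
    n                            ∎

theorem4 : (ε : ℝ) → fromℕ 0 <ℝ ε → ε <ℝ fromℚ ½ →
    Σ[ δ ∈ ℝ ] fromℕ 0 <ℝ δ ×
    ((n : ℕ) → 0 < n →
    (r c : ℕ) → r ≡ 2 * c → ¬ (2 ∣ c) → 1 ≤ c → 2 * c ≤ n →
    (k : ℕ) → 2 ∣ k →
    ε *ℝ fromℕ n <ℝ fromℕ k → fromℕ k <ℝ (fromℕ 1 -ℝ ε) *ℝ fromℕ n →
    δ *ℝ fromℕ n ≤⁺ γ n k r)
theorem4 ε (q , 0<q , N₀ , q≤ε) _ =
  fromℚ δ , (δ , 0<δ , 0 , λ _ _ → ℚ.≤-reflexive (ℚ.+-identityˡ δ)) , bound
  where
  -- `q` witnesses that ε is positive: it is a positive rational lower bound for `seq ε` from `N₀`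
  -- on.
  δ = ½ ℚ.* q
  0<δ : 0ℚ ℚ.< δ
  0<δ = subst (ℚ._< δ) (ℚ.*-zeroʳ ½) (ℚ.*-monoʳ-<-pos ½ 0<q)

  bound : (n : ℕ) → 0 < n →
    (r c : ℕ) → r ≡ 2 * c → ¬ (2 ∣ c) → 1 ≤ c → 2 * c ≤ n →
    (k : ℕ) → 2 ∣ k →
    ε *ℝ fromℕ n <ℝ fromℕ k → fromℕ k <ℝ (fromℕ 1 -ℝ ε) *ℝ fromℕ n →
    fromℚ δ *ℝ fromℕ n ≤⁺ γ n k r
  bound n _ r c refl 2∤c _ _ k 2∣k (p₁ , 0<p₁ , N₁ , εn<k) (p₂ , 0<p₂ , N₂ , k<[1-ε]n) =
    ≤⁺-γ (fromℚ δ *ℝ fromℕ n) n k r λ 𝓐 sur uniform p 0<p →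
      -- The sequences on both sides are constant, so the threshold can be 0.
      0 , λ _ _ → ℚ.<⇒≤ (begin-strict
        δ ℚ.* ι n              ≤⟨ δn≤ 𝓐 sur uniform ⟩
        ι (length 𝓐)           ≡⟨ ℚ.+-identityʳ (ι (length 𝓐)) ⟨
        ι (length 𝓐) ℚ.+ 0ℚ    <⟨ ℚ.+-monoʳ-< (ι (length 𝓐)) 0<p ⟩
        ι (length 𝓐) ℚ.+ p     ∎)
    where
    open ℚ.≤-Reasoning
    -- At one index beyond all three thresholds the real hypotheses become rational inequalities,
    -- with `e` in place of ε.
    i  = N₀ + (N₁ + N₂)
    e  = seq ε i
    q≤e : q ℚ.≤ e
    q≤e = subst (ℚ._≤ e) (ℚ.+-identityˡ q) (q≤ε i (ℕ.m≤m+n N₀ (N₁ + N₂)))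
    en<k : e ℚ.* ι n ℚ.< ι k
    en<k = a+p≤b⇒a<b 0<p₁ (εn<k i (ℕ.≤-trans (ℕ.m≤m+n N₁ N₂) (ℕ.m≤n+m (N₁ + N₂) N₀)))
    k<[1-e]n : ι k ℚ.< (ι 1 ℚ.- e) ℚ.* ι n
    k<[1-e]n = a+p≤b⇒a<b 0<p₂ (k<[1-ε]n i (ℕ.≤-trans (ℕ.m≤n+m N₂ N₁) (ℕ.m≤n+m (N₁ + N₂) N₀)))

    δn≤ : ∀ 𝓐 → SUR (bicolorings n k) 𝓐 → Uniform r 𝓐 → δ ℚ.* ι n ℚ.≤ ι (length 𝓐)
    δn≤ 𝓐 sur uniform = ℚ.≮⇒≥ λ m<δn →
      -- With m sets and m below δn, both `2 * m < k` and `k + 2 * m < n` hold, so the family is too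
      -- small to be a SUR.
      let 2m<en = ι-double-< (length 𝓐) n q≤e m<δn
      in few-sets-not-SUR 𝓐 2∤c 2∣k
           (ι-cancel-< (ℚ.<-trans 2m<en en<k))
           (ι-complement-< e k (2 * length 𝓐) n 2m<en k<[1-e]n)
           uniform sur
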